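{- There exist a constant $\kappa>0$ and an infinite set $N$ of positive integers such that for every $n\in N$ there is a family $\mathcal{G}_n$ of $n$-node feasible graphs, each of election index $1$, with the following property: for every leader election algorithm with advice that performs leader election in time $1$ in all graphs of $\mathcal{G}_n$, some graph of $\mathcal{G}_n$ receives advice of length at least $\kappa\, n\log\log n$.
   Context: A graph is a simple undirected connected graph with $n\ge 3$ anonymous nodes; at each node of degree $d$ the incident edges carry distinct port numbers $0,\dots,d-1$ (local, unrelated at the two endpoints of an edge). The truncated view $\mathcal{V}^l(v)$ is defined inductively: $\mathcal{V}^0(v)$ is a single node; $\mathcal{V}^{l+1}(v)$ is the port-labeled tree rooted at $x_0$ having, for each neighbor $v_i$ of $v$, a child $x_i$ with the ports of edge $\{x_0,x_i\}$ equal to the ports of edge $\{v,v_i\}$ at $v$ and at $v_i$ respectively, and $x_i$ the root of a copy of $\mathcal{V}^l(v_i)$; the view is the infinite limit. The augmented truncated view $\mathcal{B}^l(v)$ is $\mathcal{V}^l(v)$ with leaves labeled by their degrees. A graph is feasible if all node views are distinct. Model: synchronous rounds (LOCAL), all nodes start simultaneously, each round each node exchanges arbitrary messages with all neighbors; initially a node knows only its degree and the advice, so after $r$ rounds its knowledge is the advice and $\mathcal{B}^r(v)$. Leader election: each node $v$ outputs $(p_1,q_1,\dots,p_k,q_k)$ such that the path from $v$ whose $i$-th edge has port $p_i$ at the endpoint nearer $v$ and $q_i$ at the other endpoint is a simple path, and all these paths end at a common node. Time = number of rounds until all nodes output. The election index of a feasible graph is the minimum time in which leader election is possible when nodes know the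 map of the graph (isomorphic copy with ports); equivalently, the smallest $\ell$ such that all $\mathcal{B}^\ell(v)$ are distinct. Advice: an oracle knowing the whole graph gives the same binary string to all nodes at the start; a leader election algorithm with advice consists of such an oracle and a deterministic distributed algorithm. Logarithms are base 2. -}

module Defs where

open import Data.Nat using (ℕ; zero; suc; _≤_; _<_; _*_)
open import Data.Nat.Logarithm using (⌊log₂_⌋)
open import Data.Fin using (Fin; toℕ)
open import Data.List using (List; []; _∷_; map; allFin; length)
open import Data.List.Relation.Unary.Unique.Propositional using (Unique)
open import Data.Bool using (Bool)
open import Data.Product using (Σ; _×_; _,_; ∃)
open import Relation.Binary.PropositionalEquality using (_≡_; _≢_)
open import Relation.Nullary using (¬_)
open import Function.Definitions using (Injective)

-- Port-labelled simple graph on node set Fin n.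
-- nbr v p  : neighbour of v reached by port p at v
-- back v p : the port of that same edge at the other endpoint
record PGraph (n : ℕ) : Set where
  field
    three≤n  : 3 ≤ n
    deg      : Fin n → ℕ
    nbr      : (v : Fin n) → Fin (deg v) → Fin n
    back     : (v : Fin n) (p : Fin (deg v)) → Fin (deg (nbr v p))
    nbr-back : ∀ v p → nbr (nbr v p) (back v p) ≡ v
    back-back : ∀ v p → toℕ (back (nbr v p) (back v p)) ≡ toℕ p
    no-loop  : ∀ v p → nbr v p ≢ v
    no-multi : ∀ v p p′ → nbr v p ≡ nbr v p′ → p ≡ p′

open PGraph public

data Walk {n : ℕ} (G : PGraph n) : Fin n → List (ℕ × ℕ) → List (Fin n) → Fin n → Set where
  here : ∀ v → Walk G v [] (v ∷ []) v
  step : ∀ v (p : Fin (deg G v)) {ps ns w} →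
         Walk G (nbr G v p) ps ns w →
         Walk G v ((toℕ p , toℕ (back G v p)) ∷ ps) (v ∷ ns) w

Connected : ∀ {n} → PGraph n → Set
Connected {n} G = ∀ (u w : Fin n) → Σ (List (ℕ × ℕ)) λ ps → Σ (List (Fin n)) λ ns → Walk G u ps ns w

record Graph (n : ℕ) : Set where
  field
    pg        : PGraph n
    connected : Connected pg

open Graph public

-- Port-labelled rooted trees (truncated views).
-- bare   : an unlabelled leaf (leaves of V^l)
-- leaf d : a leaf labelled by degree d (leaves of B^l)
-- node cs: root whose children, in port order, are (port at root, port at child, subtree)
data Tree : Set where
  bare : Tree
  leaf : ℕ → Tree
  node : List (ℕ × ℕ × Tree) → Tree

V : ∀ {n} → PGraph n → ℕ → Fin n → Tree
V G zero v = bare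
V G (suc l) v = node (map (λ p → (toℕ p , toℕ (back G v p) , V G l (nbr G v p))) (allFin (deg G v)))

B : ∀ {n} → PGraph n → ℕ → Fin n → Tree
B G zero v = leaf (deg G v)
B G (suc l) v = node (map (λ p → (toℕ p , toℕ (back G v p) , B G l (nbr G v p))) (allFin (deg G v)))

-- Feasible: all (infinite) views are distinct; two infinite views coincide
-- iff all their truncations coincide.
Feasible : ∀ {n} → Graph n → Set
Feasible {n} G = ∀ (v w : Fin n) → (∀ l → V (pg G) l v ≡ V (pg G) l w) → v ≡ w

ElectionIndex : ∀ {n} → Graph n → ℕ → Set
ElectionIndex G ℓ = Injective _≡_ _≡_ (B (pg G) ℓ) × (∀ l → l < ℓ → ¬ Injective _≡_ _≡_ (B (pg G) l))

ElectsLeader : ∀ {n} → Graph n → (Fin n → List (ℕ × ℕ)) → Set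
ElectsLeader {n} G out = Σ (Fin n) λ leader → ∀ v → Σ (List (Fin n)) λ ns → Walk (pg G) v (out v) ns leader × Unique ns

-- Time-1 algorithm with advice: the oracle gives advice (oracle G) to all nodes;
-- after 1 round node v knows exactly the advice and B^1(v), so its output is
-- alg (oracle G) (B^1(v)).
Oracle : ℕ → Set
Oracle n = Graph n → List Bool

Alg1 : Set
Alg1 = List Bool → Tree → List (ℕ × ℕ)

SolvesInTime1 : ∀ {n} → Oracle n → Alg1 → Graph n → Set
SolvesInTime1 oracle alg G = ElectsLeader G (λ v → alg (oracle G) (B (pg G) 1 v))

{-# OPTIONS --safe #-}
module Submission where

-- Take a ring of k blocks, each a clique of size Θ(log k / log log k) attached to the ring
-- through a hub, and let the port numbering of the other clique nodes carry a code which
-- identifies the block and which all nodes of the block read off their back ports in one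
-- round.  The family consists of 2 ^ Ω(k log k) = 2 ^ Ω(n log log n) arrangements of the k
-- blocks around the ring, one block being kept fixed.  A hub sees the same view in every
-- arrangement, so under equal advice it outputs the same route to the leader; since the
-- displacement along the ring can be read off a route, the routes determine the arrangement.
-- Hence all advice strings differ, and one of them is long.

open import Defs
open import Data.Bool using (Bool; true; false)
open import Data.Fin using (Fin; zero; suc; toℕ; fromℕ<; inject₁; inject≤; join; splitAt; punchIn; punchOut; combine; finToFun; funToFin; _↑ˡ_; _↑ʳ_)
open import Data.Fin.Permutation as Perm using (Permutation′; _⟨$⟩ʳ_; _⟨$⟩ˡ_; lift₀; insert)
open import Data.Fin.Properties using (toℕ-injective; toℕ<n; toℕ-fromℕ<; toℕ-↑ˡ; toℕ-↑ʳ; ↑ˡ-injective; ↑ʳ-injective; splitAt-join; join-splitAt; toℕ-inject₁; suc-injective; punchInᵢ≢i; punchIn-injective; punchIn-punchOut; *↔×; funToFin-finToFin; inject≤-injective; pigeonhole; any?) renaming (_≟_ to _≟ᶠ_)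
open import Data.List using (List; []; _∷_; map; allFin; length; tabulate)
open import Data.List.Properties using (map-∘; map-cong; length-map; ∷-injective; map-tabulate; length-tabulate; tabulate-cong)
open import Data.Nat using (ℕ; zero; suc; pred; _+_; _*_; _∸_; _^_; _≤_; _<_; z≤n; s≤s; NonZero; >-nonZero; _≤?_; _%_)
open import Data.Nat.DivMod using (_mod_; %-distribˡ-+; m%n%n≡m%n; [m+n]%n≡m%n; m<n⇒m%n≡m; m%n<n)
open import Data.Nat.Logarithm using (⌊log₂_⌋; ⌊log₂⌋-mono-≤; ⌊log₂[2^n]⌋≡n)
open import Data.Nat.Solver using (module +-*-Solver)
open import Data.Nat.Properties hiding (suc-injective)
open import Data.Product using (Σ; _×_; _,_; proj₁; proj₂; ∃₂; ∃-syntax)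
open import Data.Sum using (_⊎_; inj₁; inj₂)
open import Function using (_∘_; _↔_; Inverse)
open import Function.Definitions using (Injective)
open import Relation.Binary.PropositionalEquality
open import Relation.Nullary using (¬_; yes; no; contradiction)

-- Dart presentations of port-labelled graphs and their depth-one views.

tabulate-injective : ∀ {a} {A : Set a} {n} {f g : Fin n → A} →
  tabulate f ≡ tabulate g → ∀ i → f i ≡ g i
tabulate-injective eq zero    = proj₁ (∷-injective eq)
tabulate-injective eq (suc i) = tabulate-injective (proj₂ (∷-injective eq)) i

-- A port-labelled graph given by its darts: rot sends a dart (node, port) to
-- the dart of the same edge at the other endpoint.  Ports live in an arbitrary
-- type and are numbered by enc.
record Net (A : Set) : Set₁ where
  field
    degree   : A → ℕ
    Port     : A → Set
    enc      : ∀ v → Port v → Fin (degree v)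
    dec      : ∀ v → Fin (degree v) → Port v
    dec-enc  : ∀ v p → dec v (enc v p) ≡ p
    enc-dec  : ∀ v q → enc v (dec v q) ≡ q
    rot      : Σ A Port → Σ A Port
    rot-rot  : ∀ d → rot (rot d) ≡ d
    loopless : ∀ v p → proj₁ (rot (v , p)) ≢ v
    simple   : ∀ v p p′ → proj₁ (rot (v , p)) ≡ proj₁ (rot (v , p′)) → p ≡ p′

  number : Σ A Port → ℕ
  number (v , p) = toℕ (enc v p)

  -- One child of the root in the augmented view of depth one; `row v` is the list of all children
  -- (see `B1-row`).
  entry : Σ A Port → ℕ × ℕ × Tree
  entry d = number d , number (rot d) , leaf (degree (proj₁ (rot d)))

  row : A → List (ℕ × ℕ × Tree)
  row v = tabulate (λ q → entry (v , dec v q))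

row-degree : ∀ {A A′ : Set} (M : Net A) (N : Net A′) v w →
  Net.row M v ≡ Net.row N w → Net.degree M v ≡ Net.degree N w
row-degree M N v w eq = trans (sym (length-tabulate _)) (trans (cong length eq) (length-tabulate _))

-- Rows are ordered by port number and equal rows have equal length, so a port number picks out the
-- same position in both.
row-entry : ∀ {A A′ : Set} (M : Net A) (N : Net A′) v w → Net.row M v ≡ Net.row N w →
  ∀ p q → Net.number M (v , p) ≡ Net.number N (w , q) → Net.entry M (v , p) ≡ Net.entry N (w , q)
row-entry M N v w eq p q num =
  trans (cong (λ p → M.entry (v , p)) (sym (M.dec-enc v p)))
    (trans (tabulate-at (row-degree M N v w eq) eq _ _ num) (cong (λ q → N.entry (w , q)) (N.dec-enc w q)))
  where
  module M = Net M
  module N = Net N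
  tabulate-at : ∀ {m n} {f : Fin m → ℕ × ℕ × Tree} {g : Fin n → ℕ × ℕ × Tree} → m ≡ n →
    tabulate f ≡ tabulate g → ∀ i j → toℕ i ≡ toℕ j → f i ≡ g j
  tabulate-at {g = g} refl eq i j ij = trans (tabulate-injective eq i) (cong g (toℕ-injective ij))

module _ {A : Set} (N : Net A) where
  open Net N

  data Path : A → A → Set where
    stop : ∀ {v} → Path v v
    go   : ∀ {v w} (p : Port v) → Path (proj₁ (rot (v , p))) w → Path v w

  Path-trans : ∀ {u v w} → Path u v → Path v w → Path u w
  Path-trans stop     r = r
  Path-trans (go p q) r = go p (Path-trans q r)

  edge : ∀ {v w} (p : Port v) → proj₁ (rot (v , p)) ≡ w → Path v w
  edge p refl = go p stop

  Path-sym : ∀ {u v} → Path u v → Path v u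
  Path-sym stop = stop
  Path-sym {u} (go p q) =
    Path-trans (Path-sym q) (edge (proj₂ (rot (u , p))) (cong proj₁ (rot-rot (u , p))))

-- Realising a net as a graph on `Fin n`.

module Realise {A : Set} {n : ℕ} (N : Net A) (ix : Fin n ↔ A) (3≤n : 3 ≤ n) where
  open Net N

  to : Fin n → A
  to = Inverse.to ix

  from : A → Fin n
  from = Inverse.from ix

  to-from : ∀ a → to (from a) ≡ a
  to-from = Inverse.strictlyInverseˡ ix

  from-to : ∀ i → from (to i) ≡ i
  from-to = Inverse.strictlyInverseʳ ix

  -- `to (from a)` equals `a` only propositionally, so the port at the far end of an edge has to be
  -- transported; the next two lemmas remove the transport again.
  portAt : ∀ {a a′} → a′ ≡ a → Port a → Fin (degree a′)
  portAt eq p = subst (Fin ∘ degree) (sym eq) (enc _ p)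

  toℕ-portAt : ∀ {a a′} (eq : a′ ≡ a) p → toℕ (portAt eq p) ≡ number (a , p)
  toℕ-portAt refl p = refl

  dec-portAt : ∀ {a a′} (eq : a′ ≡ a) p → (a′ , dec a′ (portAt eq p)) ≡ (a , p)
  dec-portAt refl p = cong (_ ,_) (dec-enc _ p)

  dart : (v : Fin n) → Fin (degree (to v)) → Σ A Port
  dart v p = to v , dec (to v) p

  nb : (v : Fin n) → Fin (degree (to v)) → Fin n
  nb v p = from (proj₁ (rot (dart v p)))

  bk : (v : Fin n) (p : Fin (degree (to v))) → Fin (degree (to (nb v p)))
  bk v p = portAt (to-from _) (proj₂ (rot (dart v p)))

  dart-rot : ∀ v p → dart (nb v p) (bk v p) ≡ rot (dart v p)
  dart-rot v p = dec-portAt (to-from _) (proj₂ (rot (dart v p)))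

  rot-back : ∀ v p → rot (dart (nb v p) (bk v p)) ≡ dart v p
  rot-back v p = trans (cong rot (dart-rot v p)) (rot-rot (dart v p))

  dec-injective : ∀ {a p q} → dec a p ≡ dec a q → p ≡ q
  dec-injective {a} {p} {q} eq = trans (sym (enc-dec a p)) (trans (cong (enc a) eq) (enc-dec a q))

  graph : PGraph n
  graph = record
    { three≤n   = 3≤n
    ; deg       = degree ∘ to
    ; nbr       = nb
    ; back      = bk
    ; nbr-back  = λ v p → trans (cong (from ∘ proj₁) (rot-back v p)) (from-to v)
    ; back-back = λ v p → trans (toℕ-portAt (to-from _) _)
                     (trans (cong number (rot-back v p)) (cong toℕ (enc-dec (to v) p)))
    ; no-loop   = λ v p eq → loopless (to v) _ (trans (sym (to-from _)) (cong to eq))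
    ; no-multi  = λ v p p′ eq → dec-injective (simple (to v) _ _
                     (trans (sym (to-from _)) (trans (cong to eq) (to-from _))))
    }

  B1-row : ∀ v → B graph 1 v ≡ node (row (to v))
  B1-row v = cong node (trans (map-tabulate (λ p → p) _) (tabulate-cong λ p →
    cong₂ _,_ (sym (cong toℕ (enc-dec (to v) p)))
      (cong₂ (λ b a → b , leaf (degree a)) (toℕ-portAt (to-from _) _) (to-from _))))

  walk : ∀ {a b} → Path N a b → ∀ u → to u ≡ a → ∃₂ λ ps ns → Walk graph u ps ns (from b)
  walk stop     u refl = _ , _ , subst (Walk graph u [] _) (sym (from-to u)) (here u)
  walk (go p q) u refl with walk q (nb u (enc (to u) p)) (trans (to-from _) (cong (λ p → proj₁ (rot (to u , p))) (dec-enc _ p)))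
  ... | ps , ns , w = _ , _ , step u (enc (to u) p) w

  connectedGraph : (∀ a b → Path N a b) → Graph n
  connectedGraph path = record
    { pg = graph
    ; connected = λ u w → subst (λ w → ∃₂ λ ps ns → Walk graph u ps ns w) (from-to w) (walk (path (to u) (to w)) u refl)
    }

-- From distinct augmented views of depth one to feasibility.

node-injective : ∀ {cs ds} → node cs ≡ node ds → cs ≡ ds
node-injective refl = refl

leaf-injective : ∀ {c d} → leaf c ≡ leaf d → c ≡ d
leaf-injective refl = refl

width : Tree → ℕ
width bare      = 0
width (leaf _)  = 0
width (node cs) = length cs

-- Turns `V` at depth 2 into `B` at depth 1: the degree of a neighbour is the number of children of
-- its subtree.
prune : Tree → Tree
prune (node cs) = node (map (λ (p , q , t) → p , q , leaf (width t)) cs)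
prune t         = t

prune-V : ∀ {n} (G : PGraph n) v → prune (V G 2 v) ≡ B G 1 v
prune-V G v = cong node (trans (sym (map-∘ (allFin (deg G v)))) (map-cong (λ p →
  cong (λ d → toℕ p , toℕ (back G v p) , leaf d) (trans (length-map _ (allFin (deg G (nbr G v p)))) (length-tabulate _)))
  (allFin (deg G v))))

B1-injective⇒Feasible : ∀ {n} (G : Graph n) → Injective _≡_ _≡_ (B (pg G) 1) → Feasible G
B1-injective⇒Feasible G inj v w eq = inj (trans (sym (prune-V (pg G) v)) (trans (cong prune (eq 2)) (prune-V (pg G) w)))

-- Cyclic shifts of `Fin (suc N)`.

shift : ∀ {N} → ℕ → Fin (suc N) → Fin (suc N)
shift {N} a m = (toℕ m + a) mod suc N

toℕ-shift : ∀ {N} a (m : Fin (suc N)) → toℕ (shift a m) ≡ (toℕ m + a) % suc N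
toℕ-shift {N} a m = toℕ-fromℕ< (m%n<n (toℕ m + a) (suc N))

%-+ : ∀ m a n .{{_ : NonZero n}} → (m % n + a) % n ≡ (m + a) % n
%-+ m a n = begin
  (m % n + a) % n         ≡⟨ %-distribˡ-+ (m % n) a n ⟩
  (m % n % n + a % n) % n ≡⟨ cong (λ c → (c + a % n) % n) (m%n%n≡m%n m n) ⟩
  (m % n + a % n) % n     ≡⟨ %-distribˡ-+ m a n ⟨
  (m + a) % n             ∎
  where open ≡-Reasoning

shift-∘ : ∀ {N} a b (m : Fin (suc N)) → shift b (shift a m) ≡ shift (a + b) m
shift-∘ {N} a b m = toℕ-injective (begin
  toℕ (shift b (shift a m))           ≡⟨ toℕ-shift b (shift a m) ⟩
  (toℕ (shift a m) + b) % suc N       ≡⟨ cong (λ c → (c + b) % suc N) (toℕ-shift a m) ⟩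
  ((toℕ m + a) % suc N + b) % suc N   ≡⟨ %-+ (toℕ m + a) b (suc N) ⟩
  (toℕ m + a + b) % suc N             ≡⟨ cong (_% suc N) (+-assoc (toℕ m) a b) ⟩
  (toℕ m + (a + b)) % suc N           ≡⟨ toℕ-shift (a + b) m ⟨
  toℕ (shift (a + b) m)               ∎)
  where open ≡-Reasoning

shift-0 : ∀ {N} (m : Fin (suc N)) → shift 0 m ≡ m
shift-0 m = toℕ-injective (trans (toℕ-shift 0 m)
  (trans (cong (_% _) (+-identityʳ (toℕ m))) (m<n⇒m%n≡m (toℕ<n m))))

shift-full : ∀ {N} (m : Fin (suc N)) → shift (suc N) m ≡ m
shift-full {N} m = toℕ-injective (trans (toℕ-shift (suc N) m)
  (trans ([m+n]%n≡m%n (toℕ m) (suc N)) (m<n⇒m%n≡m (toℕ<n m))))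

shift-cancel : ∀ {N} a b (m : Fin (suc N)) → a + b ≡ suc N → shift b (shift a m) ≡ m
shift-cancel a b m eq = trans (shift-∘ a b m) (trans (cong (λ c → shift c m) eq) (shift-full m))

-- Shifting on by the complement of `m` leaves the residue of the shift amount, which is the amount
-- itself below the modulus.
shift-injectiveˡ : ∀ {N a b} (m : Fin (suc N)) → a < suc N → b < suc N → shift a m ≡ shift b m → a ≡ b
shift-injectiveˡ {N} {a} {b} m a<N b<N eq = trans (sym (recover a a<N)) (trans (cong (λ i → toℕ (shift (suc N ∸ toℕ m) i)) eq) (recover b b<N))
  where
  recover : ∀ c → c < suc N → toℕ (shift (suc N ∸ toℕ m) (shift c m)) ≡ c
  recover c c<N = begin
    toℕ (shift (suc N ∸ toℕ m) (shift c m))  ≡⟨ cong toℕ (shift-∘ c _ m) ⟩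
    toℕ (shift (c + (suc N ∸ toℕ m)) m)      ≡⟨ toℕ-shift _ m ⟩
    (toℕ m + (c + (suc N ∸ toℕ m))) % suc N  ≡⟨ cong (_% suc N) (+-comm (toℕ m) _) ⟩
    (c + (suc N ∸ toℕ m) + toℕ m) % suc N    ≡⟨ cong (_% suc N) (+-assoc c _ (toℕ m)) ⟩
    (c + (suc N ∸ toℕ m + toℕ m)) % suc N    ≡⟨ cong (λ d → (c + d) % suc N) (m∸n+n≡m (<⇒≤ (toℕ<n m))) ⟩
    (c + suc N) % suc N                      ≡⟨ [m+n]%n≡m%n c (suc N) ⟩
    c % suc N                                ≡⟨ m<n⇒m%n≡m c<N ⟩
    c                                        ∎
    where open ≡-Reasoning

shift-suc : ∀ {N} (s : Fin N) → shift 1 (inject₁ s) ≡ suc s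
shift-suc {N} s = toℕ-injective (begin
  toℕ (shift 1 (inject₁ s))      ≡⟨ toℕ-shift 1 (inject₁ s) ⟩
  (toℕ (inject₁ s) + 1) % suc N  ≡⟨ cong (λ c → (c + 1) % suc N) (toℕ-inject₁ s) ⟩
  (toℕ s + 1) % suc N            ≡⟨ cong (_% suc N) (+-comm (toℕ s) 1) ⟩
  suc (toℕ s) % suc N            ≡⟨ m<n⇒m%n≡m (s≤s (toℕ<n s)) ⟩
  suc (toℕ s)                    ∎)
  where open ≡-Reasoning

-- The ring of cliques.

-- The edges of the complete graph on Fin (1 + x), as an involution on darts.
flipDart : ∀ {x} → Fin (suc x) × Fin x → Fin (suc x) × Fin x
flipDart (l , m) = punchIn l m , punchOut (punchInᵢ≢i l m)

-- With the dart `(l , m)` read as the ordered pair of `l` and `punchIn l m`, `flipDart` swaps the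
-- pair.
flipDart-involutive : ∀ {x} (d : Fin (suc x) × Fin x) → flipDart (flipDart d) ≡ d
flipDart-involutive (l , m) = same
  (punchIn-punchOut (punchInᵢ≢i l m))
  (punchIn-punchOut (punchInᵢ≢i (punchIn l m) (punchOut (punchInᵢ≢i l m))))
  where
  same : ∀ {l′ m′} → l′ ≡ l → punchIn l′ m′ ≡ punchIn l m → (l′ , m′) ≡ (l , m)
  same {m′ = m′} refl eq = cong (l ,_) (punchIn-injective l m′ m eq)

-- A ring of k = 1 + k′ blocks.  A block is a clique on Fin (1 + x) with x = 1 + x′;
-- its node zero, the hub, lies on the ring.  Ports 0 … x - 1 of a hub lead into the
-- clique, port x to the next hub and port x + 1 to the previous one.
module Ring (x′ k′ : ℕ) where
  x k : ℕ
  x = suc x′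
  k = suc k′

  Node : Set
  Node = Fin k × Fin (suc x)

  Port : Node → Set
  Port (s , zero)  = Fin x ⊎ Fin 2
  Port (s , suc i) = Fin x

  degree : Node → ℕ
  degree (s , zero)  = x + 2
  degree (s , suc i) = x

  clique : Fin k → Fin (suc x) × Fin x → Σ Node Port
  clique s (zero  , m) = (s , zero) , inj₁ m
  clique s (suc i , m) = (s , suc i) , m

  -- `k′` is -1 modulo `k`, so `prev` is a shift as well.
  next prev : Fin k → Fin k
  next = shift 1
  prev = shift k′

  prev-next : ∀ s → prev (next s) ≡ s
  prev-next s = shift-cancel 1 k′ s refl

  next-prev : ∀ s → next (prev s) ≡ s
  next-prev s = shift-cancel k′ 1 s (+-comm k′ 1)

  rot : Σ Node Port → Σ Node Port
  rot ((s , zero)  , inj₁ m)          = clique s (flipDart (zero , m))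
  rot ((s , zero)  , inj₂ zero)       = (next s , zero) , inj₂ (suc zero)
  rot ((s , zero)  , inj₂ (suc zero)) = (prev s , zero) , inj₂ zero
  rot ((s , suc i) , m)               = clique s (flipDart (suc i , m))

  rot-clique : ∀ s d → rot (clique s d) ≡ clique s (flipDart d)
  rot-clique s (zero  , m) = refl
  rot-clique s (suc i , m) = refl

  rot-clique² : ∀ s d → rot (clique s (flipDart d)) ≡ clique s d
  rot-clique² s d = trans (rot-clique s (flipDart d)) (cong (clique s) (flipDart-involutive d))

  clique-node : ∀ s d → proj₁ (clique s d) ≡ (s , proj₁ d)
  clique-node s (zero  , m) = refl
  clique-node s (suc i , m) = refl

  rot-rot : ∀ d → rot (rot d) ≡ d
  rot-rot ((s , zero)  , inj₁ m)          = rot-clique² s (zero , m)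
  rot-rot ((s , zero)  , inj₂ zero)       = cong (λ s → (s , zero) , inj₂ zero) (prev-next s)
  rot-rot ((s , zero)  , inj₂ (suc zero)) = cong (λ s → (s , zero) , inj₂ (suc zero)) (next-prev s)
  rot-rot ((s , suc i) , m)               = rot-clique² s (suc i , m)

  -- The change of block caused by leaving through port number `p`. For each fixed `p` it is a
  -- bijection of the ring, so routes can be traced back from their end.
  move : ℕ → Fin k → Fin k
  move p s with p <? x | p ≟ x
  ... | yes _ | _     = s
  ... | no _  | yes _ = next s
  ... | no _  | no _  = prev s

  move-inner : ∀ {p} s → p < x → s ≡ move p s
  move-inner {p} s p<x with p <? x | p ≟ x
  ... | yes _   | _ = refl
  ... | no p≮x  | _ = contradiction p<x p≮x

  move-next : ∀ {p} s → p ≡ x → next s ≡ move p s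
  move-next {p} s p≡x with p <? x | p ≟ x
  ... | yes p<x | _      = contradiction p≡x (<⇒≢ p<x)
  ... | no _    | yes _  = refl
  ... | no _    | no p≢x = contradiction p≡x p≢x

  move-prev : ∀ {p} s → p ≡ suc x → prev s ≡ move p s
  move-prev {p} s p≡1+x with p <? x | p ≟ x
  ... | yes p<x | _       = contradiction (subst (_< x) p≡1+x p<x) (<⇒≯ (n<1+n x))
  ... | no _    | yes p≡x = contradiction (trans (sym p≡x) p≡1+x) (<⇒≢ (n<1+n x))
  ... | no _    | no _    = refl

  move-injective : ∀ p s t → move p s ≡ move p t → s ≡ t
  move-injective p s t eq with p <? x | p ≟ x
  ... | yes _ | _     = eq
  ... | no _  | yes _ = trans (sym (prev-next s)) (trans (cong prev eq) (prev-next t))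
  ... | no _  | no _  = trans (sym (next-prev s)) (trans (cong next eq) (next-prev t))

  -- The block reached from block s is a function of the ports taken, whatever the codes,
  -- because only the ring edges carry hub-side port numbers ≥ x.
  route : List (ℕ × ℕ) → Fin k → Fin k
  route []             s = s
  route ((p , _) ∷ ps) s = route ps (move p s)

  route-injective : ∀ ps s t → route ps s ≡ route ps t → s ≡ t
  route-injective []             s t eq = eq
  route-injective ((p , _) ∷ ps) s t eq = move-injective p s t (route-injective ps _ _ eq)

  -- The port numbers of clique node suc i of block s are rotated by code s i.
  module Coded (3≤k : 3 ≤ k) (code : Fin k → Fin x → Fin x) where

    next≢ : ∀ s → next s ≢ s
    next≢ s eq with shift-injectiveˡ {a = 1} {b = 0} s (≤-trans (s≤s (s≤s z≤n)) 3≤k) (s≤s z≤n) (trans eq (sym (shift-0 s)))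
    ... | ()

    prev≢ : ∀ s → prev s ≢ s
    prev≢ s eq = next≢ s (trans (cong next (sym eq)) (next-prev s))

    next≢prev : ∀ s → next s ≢ prev s
    next≢prev s eq with shift-injectiveˡ {a = 1} {b = k′} s (≤-trans (s≤s (s≤s z≤n)) 3≤k) ≤-refl eq
    -- Here `k′` is 1, so the ring would have only two blocks.
    next≢prev s eq | refl = contradiction 3≤k λ { (s≤s (s≤s ())) }

    enc : ∀ v → Port v → Fin (degree v)
    enc (s , zero)  p = join x 2 p
    enc (s , suc i) m = shift (toℕ (code s i)) m

    dec : ∀ v → Fin (degree v) → Port v
    dec (s , zero)  q = splitAt x q
    dec (s , suc i) q = shift (x ∸ toℕ (code s i)) q

    dec-enc : ∀ v p → dec v (enc v p) ≡ p
    dec-enc (s , zero)  p = splitAt-join x 2 p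
    dec-enc (s , suc i) m = shift-cancel (toℕ (code s i)) _ m (m+[n∸m]≡n (<⇒≤ (toℕ<n (code s i))))

    enc-dec : ∀ v q → enc v (dec v q) ≡ q
    enc-dec (s , zero)  q = join-splitAt x 2 q
    enc-dec (s , suc i) q = shift-cancel _ (toℕ (code s i)) q (m∸n+n≡m (<⇒≤ (toℕ<n (code s i))))

    loopless : ∀ v p → proj₁ (rot (v , p)) ≢ v
    loopless (s , zero)  (inj₁ m)          eq = contradiction eq λ ()
    loopless (s , zero)  (inj₂ zero)       eq = next≢ s (cong proj₁ eq)
    loopless (s , zero)  (inj₂ (suc zero)) eq = prev≢ s (cong proj₁ eq)
    loopless (s , suc i) m eq =
      punchInᵢ≢i (suc i) m (cong proj₂ (trans (sym (clique-node s (flipDart (suc i , m)))) eq))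

    simple : ∀ v p p′ → proj₁ (rot (v , p)) ≡ proj₁ (rot (v , p′)) → p ≡ p′
    simple (s , zero) (inj₁ m) (inj₁ m′) eq = cong inj₁ (suc-injective (cong proj₂ eq))
    simple (s , zero) (inj₁ m) (inj₂ zero) ()
    simple (s , zero) (inj₁ m) (inj₂ (suc zero)) ()
    simple (s , zero) (inj₂ zero) (inj₁ m) ()
    simple (s , zero) (inj₂ (suc zero)) (inj₁ m) ()
    simple (s , zero) (inj₂ zero) (inj₂ zero) eq = refl
    simple (s , zero) (inj₂ zero) (inj₂ (suc zero)) eq = contradiction (cong proj₁ eq) (next≢prev s)
    simple (s , zero) (inj₂ (suc zero)) (inj₂ zero) eq = contradiction (cong proj₁ (sym eq)) (next≢prev s)
    simple (s , zero) (inj₂ (suc zero)) (inj₂ (suc zero)) eq = refl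
    simple (s , suc i) m m′ eq = punchIn-injective (suc i) m m′ (cong proj₂
      (trans (sym (clique-node s (flipDart (suc i , m)))) (trans eq (clique-node s (flipDart (suc i , m′))))))

    net : Net Node
    net = record
      { degree = degree ; Port = Port ; enc = enc ; dec = dec ; dec-enc = dec-enc ; enc-dec = enc-dec
      ; rot = rot ; rot-rot = rot-rot ; loopless = loopless ; simple = simple }

    toHub : ∀ s l → Path net (s , l) (s , zero)
    toHub s zero    = stop
    -- `punchIn (suc i) zero` is `zero`, so the unrotated port `zero` of an inner node leads to the
    -- hub.
    toHub s (suc i) = edge net zero refl

    -- The recursion runs on `n` because `inject₁ s` is not a subterm of `suc s`.
    fromOrigin : ∀ n s → toℕ s ≡ n → Path net (zero , zero) (s , zero)
    fromOrigin n       zero    eq = stop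
    fromOrigin (suc n) (suc s) eq = Path-trans net
      (fromOrigin n (inject₁ s) (trans (toℕ-inject₁ s) (cong pred eq)))
      (edge net (inj₂ zero) (cong (_, zero) (shift-suc s)))

    toOrigin : ∀ v → Path net v (zero , zero)
    toOrigin (s , l) = Path-trans net (toHub s l) (Path-sym net (fromOrigin _ s refl))

    path : ∀ v w → Path net v w
    path v w = Path-trans net (toOrigin v) (Path-sym net (toOrigin w))

    -- What a row of the coded ring reveals.

    open Net net using (number; row; entry)

    -- Rotation keeps the port numbers of inner nodes below `x`, so the number alone tells whether
    -- and how the block changes.
    number-move : ∀ v p → proj₁ (proj₁ (rot (v , p))) ≡ move (number (v , p)) (proj₁ v)
    number-move (s , zero) (inj₁ m) =
      move-inner s (subst (_< x) (sym (toℕ-↑ˡ m 2)) (toℕ<n m))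
    number-move (s , zero) (inj₂ zero) =
      move-next s (trans (toℕ-↑ʳ x (zero {1})) (+-identityʳ x))
    number-move (s , zero) (inj₂ (suc zero)) =
      move-prev s (trans (toℕ-↑ʳ x (suc (zero {0}))) (+-comm x 1))
    number-move (s , suc i) m = trans (cong proj₁ (clique-node s (flipDart (suc i , m))))
      (move-inner s (toℕ<n (enc (s , suc i) m)))

    -- At node `suc j` the number is the unrotated port shifted by the code letter, and the shift
    -- amount can be recovered.
    number-code : ∀ s s′ d j → proj₁ d ≡ suc j → number (clique s d) ≡ number (clique s′ d) → code s j ≡ code s′ j
    number-code s s′ (_ , m) j refl eq =
      toℕ-injective (shift-injectiveˡ m (toℕ<n (code s j)) (toℕ<n (code s′ j)) (toℕ-injective eq))

    row-back : ∀ v w p q → row v ≡ row w → number (v , p) ≡ number (w , q) →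
      number (rot (v , p)) ≡ number (rot (w , q)) × degree (proj₁ (rot (v , p))) ≡ degree (proj₁ (rot (w , q)))
    row-back v w p q eq num =
      cong (proj₁ ∘ proj₂) entries , leaf-injective (cong (proj₂ ∘ proj₂) entries)
      where
      entries : entry (v , p) ≡ entry (w , q)
      entries = row-entry net net v w eq p q num

    x+2≢x : x + 2 ≢ x
    x+2≢x eq = <⇒≢ (m<m+n x (s≤s z≤n)) (sym eq)

    -- The hub port `inj₁ i` leads to clique node `suc i`, whose back port carries `code s i`.
    hub-row-code : ∀ s s′ → row (s , zero) ≡ row (s′ , zero) → ∀ i → code s i ≡ code s′ i
    hub-row-code s s′ eq i = number-code s s′ (flipDart (zero , i)) i refl
      (proj₁ (row-back (s , zero) (s′ , zero) (inj₁ i) (inj₁ i) eq refl))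

    -- Only the port to the hub leads to a neighbour of degree x + 2, so it is recognised
    -- in the row; it reveals i as the port at the hub and code s i as the own port.
    inner-row-hub : ∀ s s′ i i′ → row (s , suc i) ≡ row (s′ , suc i′) → i ≡ i′ × code s i ≡ code s′ i′
    inner-row-hub s s′ i i′ eq = at-hub (dec (s′ , suc i′) port) (enc-dec (s′ , suc i′) port)
      where
      port : Fin x
      port = enc (s , suc i) zero
      at-hub : ∀ q → enc (s′ , suc i′) q ≡ port → i ≡ i′ × code s i ≡ code s′ i′
      at-hub zero num =
        ↑ˡ-injective 2 i i′ (toℕ-injective (proj₁ (row-back (s , suc i) (s′ , suc i′) zero zero eq (cong toℕ (sym num))))) ,
        toℕ-injective (shift-injectiveˡ {a = toℕ (code s i)} (zero {x′}) (toℕ<n (code s i)) (toℕ<n (code s′ i′)) (sym num))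
      at-hub (suc q) num = contradiction
        (proj₂ (row-back (s , suc i) (s′ , suc i′) zero (suc q) eq (cong toℕ (sym num)))) x+2≢x

    -- Equal own letters align the two rows port by port; the back port at `suc j` then carries the
    -- letter of `j`.
    inner-row-code : ∀ s s′ i → row (s , suc i) ≡ row (s′ , suc i) → code s i ≡ code s′ i → ∀ j → code s j ≡ code s′ j
    inner-row-code s s′ i eq own j with suc i ≟ᶠ suc j
    ... | yes refl = own
    ... | no i≢j   = number-code s s′ (flipDart (suc i , m)) j (punchIn-punchOut i≢j)
      (proj₁ (row-back (s , suc i) (s′ , suc i) m m eq (cong (λ c → toℕ (shift (toℕ c) m)) own)))
      where
      m : Fin x
      m = punchOut i≢j

    -- Degrees separate hubs from inner nodes. Within each kind the row determines the place in the
    -- clique and the whole code word, hence the block.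
    row-injective : (∀ s s′ → (∀ i → code s i ≡ code s′ i) → s ≡ s′) → ∀ v w → row v ≡ row w → v ≡ w
    row-injective inj (s , zero)  (s′ , zero)   eq = cong (_, zero) (inj s s′ (hub-row-code s s′ eq))
    row-injective inj v@(s , zero)  w@(s′ , suc i′) eq = contradiction (row-degree net net v w eq) x+2≢x
    row-injective inj v@(s , suc i) w@(s′ , zero)   eq = contradiction (sym (row-degree net net v w eq)) x+2≢x
    row-injective inj (s , suc i) (s′ , suc i′) eq with inner-row-hub s s′ i i′ eq
    ... | refl , own = cong (_, suc i) (inj s s′ (inner-row-code s s′ i eq own))

  -- Hub ports are never rotated and all hubs have the same degree, so the two ring entries look
  -- alike everywhere. The view of a hub thus depends on the code word of its own block only, not on
  -- its position or neighbours.
  hub-row : (3≤k : 3 ≤ k) (h h′ : Fin k → Fin x → Fin x) → ∀ s s′ → (∀ i → h s i ≡ h′ s′ i) →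
    Net.row (Coded.net 3≤k h) (s , zero) ≡ Net.row (Coded.net 3≤k h′) (s′ , zero)
  hub-row 3≤k h h′ s s′ same = tabulate-cong (λ q → entries (splitAt x q))
    where
    entries : ∀ p → Net.entry (Coded.net 3≤k h) ((s , zero) , p) ≡ Net.entry (Coded.net 3≤k h′) ((s′ , zero) , p)
    entries (inj₁ m)          = cong (λ c → toℕ (m ↑ˡ 2) , toℕ (shift (toℕ c) (punchOut (punchInᵢ≢i zero m))) , leaf x) (same m)
    entries (inj₂ zero)       = refl
    entries (inj₂ (suc zero)) = refl

  -- Leader election and election index of ring graphs.

  module Realised (3≤k : 3 ≤ k) (code : Fin k → Fin x → Fin x) where
    open Coded 3≤k code
    open Realise net (*↔× {k} {suc x}) (≤-trans 3≤k (m≤m*n k (suc x))) public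

    ringGraph : Graph (k * suc x)
    ringGraph = connectedGraph path

    walk-route : ∀ {u w ps ns} → Walk graph u ps ns w → proj₁ (to w) ≡ route ps (proj₁ (to u))
    walk-route (here v) = refl
    walk-route (step v p {ps} w) = trans (walk-route w) (cong (route ps) (trans
      (cong proj₁ (to-from _))
      (trans (number-move (to v) _) (cong (λ q → move (toℕ q) (proj₁ (to v))) (enc-dec (to v) p)))))

    B1-injective : (∀ s s′ → (∀ i → code s i ≡ code s′ i) → s ≡ s′) → Injective _≡_ _≡_ (B graph 1)
    B1-injective inj {v} {w} eq = trans (sym (from-to v)) (trans (cong from
      (row-injective inj (to v) (to w) (node-injective (trans (sym (B1-row v)) (trans eq (B1-row w)))))) (from-to w))

    hub : Fin k → Fin (k * suc x)
    hub s = from (s , zero)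

    B1-hub : ∀ s → B graph 1 (hub s) ≡ node (Net.row net (s , zero))
    B1-hub s = trans (B1-row (hub s)) (cong (node ∘ Net.row net) (to-from (s , zero)))

    leader-block : ∀ {out} → ElectsLeader ringGraph out → ∃[ c ] ∀ s → c ≡ route (out (hub s)) s
    leader-block {out} (leader , elect) = proj₁ (to leader) , λ s →
      trans (walk-route (proj₁ (proj₂ (elect (hub s))))) (cong (route (out (hub s)) ∘ proj₁) (to-from (s , zero)))

    -- All hubs have degree `x + 2`, and `next zero` is a hub position other than `zero`.
    B0-collision : ¬ Injective _≡_ _≡_ (B graph 0)
    B0-collision inj = next≢ zero (cong proj₁ (trans (sym (to-from (next zero , zero))) (trans (cong to hubs≡) (to-from (zero , zero)))))
      where
      B0-hub : ∀ s → B graph 0 (hub s) ≡ leaf (x + 2)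
      B0-hub s = cong (leaf ∘ degree) (to-from (s , zero))
      hubs≡ : hub (next zero) ≡ hub zero
      hubs≡ = inj (trans (B0-hub (next zero)) (sym (B0-hub zero)))

    electionIndex : (∀ s s′ → (∀ i → code s i ≡ code s′ i) → s ≡ s′) → ElectionIndex ringGraph 1
    electionIndex inj = B1-injective inj , λ { zero _ → B0-collision ; (suc l) (s≤s ()) }

-- Encoding functions and arrangements.

funToFin-cong : ∀ {m n} {f g : Fin m → Fin n} → (∀ i → f i ≡ g i) → funToFin f ≡ funToFin g
funToFin-cong {zero}  eq = refl
funToFin-cong {suc m} eq = cong₂ combine (eq zero) (funToFin-cong (eq ∘ suc))

finToFun-injective : ∀ m n (i j : Fin (n ^ m)) → (∀ t → finToFun {n} {m} i t ≡ finToFun j t) → i ≡ j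
finToFun-injective m n i j eq =
  trans (sym (funToFin-finToFin {m} {n} i)) (trans (funToFin-cong eq) (funToFin-finToFin {m} {n} j))

-- f selects, for each of the first a points in turn, one of the last b values still free.
scramble : ∀ {a b} → (Fin a → Fin b) → Permutation′ (a + b)
scramble {zero}  f = Perm.id
scramble {suc a} f = insert zero (suc a ↑ʳ f zero) (scramble (f ∘ suc))

-- The image of `zero` shows the first choice; deleting that value leaves the permutations built
-- from the remaining choices.
scramble-injective : ∀ {a b} (f g : Fin a → Fin b) →
  (∀ t → scramble f ⟨$⟩ʳ t ≡ scramble g ⟨$⟩ʳ t) → ∀ i → f i ≡ g i
scramble-injective {suc a} f g eq zero    = ↑ʳ-injective (suc a) (f zero) (g zero) (eq zero)
scramble-injective {suc a} f g eq (suc i) = scramble-injective (f ∘ suc) (g ∘ suc) tails i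
  where
  F G : Permutation′ _
  F = scramble (f ∘ suc)
  G = scramble (g ∘ suc)
  tails : ∀ t → F ⟨$⟩ʳ t ≡ G ⟨$⟩ʳ t
  tails t = punchIn-injective (suc a ↑ʳ f zero) _ _ (begin
    punchIn (suc a ↑ʳ f zero) (F ⟨$⟩ʳ t) ≡⟨ Perm.insert-punchIn zero _ F t ⟨
    scramble f ⟨$⟩ʳ suc t               ≡⟨ eq (suc t) ⟩
    scramble g ⟨$⟩ʳ suc t               ≡⟨ Perm.insert-punchIn zero _ G t ⟩
    punchIn (suc a ↑ʳ g zero) (G ⟨$⟩ʳ t) ≡⟨ cong (λ c → punchIn c (G ⟨$⟩ʳ t)) (eq zero) ⟨
    punchIn (suc a ↑ʳ f zero) (G ⟨$⟩ʳ t) ∎)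
    where open ≡-Reasoning

-- Counting binary strings.

-- The leading digit 1 (the case []) keeps strings of different lengths apart.
bits : List Bool → ℕ
bits []           = 1
bits (false ∷ bs) = 2 * bits bs
bits (true  ∷ bs) = suc (2 * bits bs)

bits>0 : ∀ bs → 1 ≤ bits bs
bits>0 []           = ≤-refl
bits>0 (false ∷ bs) = ≤-trans (bits>0 bs) (m≤n*m (bits bs) 2)
bits>0 (true  ∷ bs) = s≤s z≤n

bits-injective : ∀ bs cs → bits bs ≡ bits cs → bs ≡ cs
bits-injective []           []           eq = refl
bits-injective []           (false ∷ cs) eq = contradiction (sym eq) (even≢odd (bits cs) 0)
bits-injective []           (true  ∷ cs) eq = contradiction (*-cancelˡ-≡ 0 (bits cs) 2 (cong pred eq)) (<⇒≢ (bits>0 cs))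
bits-injective (false ∷ bs) []           eq = contradiction eq (even≢odd (bits bs) 0)
bits-injective (true  ∷ bs) []           eq = contradiction (*-cancelˡ-≡ 0 (bits bs) 2 (cong pred (sym eq))) (<⇒≢ (bits>0 bs))
bits-injective (false ∷ bs) (false ∷ cs) eq = cong (false ∷_) (bits-injective bs cs (*-cancelˡ-≡ _ _ 2 eq))
bits-injective (false ∷ bs) (true  ∷ cs) eq = contradiction eq (even≢odd (bits bs) (bits cs))
bits-injective (true  ∷ bs) (false ∷ cs) eq = contradiction (sym eq) (even≢odd (bits cs) (bits bs))
bits-injective (true  ∷ bs) (true  ∷ cs) eq = cong (true ∷_) (bits-injective bs cs (*-cancelˡ-≡ _ _ 2 (cong pred eq)))

bits<2^ : ∀ bs → bits bs < 2 ^ suc (length bs)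
bits<2^ []           = ≤-refl
bits<2^ (false ∷ bs) = *-monoʳ-< 2 (bits<2^ bs)
bits<2^ (true  ∷ bs) = begin
  2 + 2 * bits bs              ≡⟨ *-suc 2 (bits bs) ⟨
  2 * suc (bits bs)            ≤⟨ *-monoʳ-≤ 2 (bits<2^ bs) ⟩
  2 ^ suc (suc (length bs))    ∎
  where open ≤-Reasoning

-- Strings shorter than `L` have `bits` between 1 and `2 ^ L - 1`, which is too few values for `M`
-- distinct strings.
long-string : ∀ {M} L (f : Fin M → List Bool) → 2 ^ L ≤ M → (∀ i j → f i ≡ f j → i ≡ j) →
  ∃[ i ] L ≤ length (f i)
long-string {M} L f 2^L≤M inj with any? (λ i → L ≤? length (f i))
... | yes long = long
... | no short = collide (pigeonhole pred<M index)
  where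
  index< : ∀ i → pred (bits (f i)) < pred (2 ^ L)
  index< i = pred-mono-< {{>-nonZero (bits>0 (f i))}} (<-≤-trans (bits<2^ (f i))
    (^-monoʳ-≤ 2 (≰⇒> (λ L≤ → short (i , L≤)))))
  -- The value 0 is never taken by `bits`; `pred` closes this gap, and without it the pigeonhole
  -- would lack one when `M` is `2 ^ L`.
  index : Fin M → Fin (pred (2 ^ L))
  index i = fromℕ< (index< i)
  pred<M : pred (2 ^ L) < M
  pred<M = ≤-trans (≤-reflexive (suc-pred (2 ^ L) {{m^n≢0 2 L}})) 2^L≤M
  collide : (∃₂ λ i j → toℕ i < toℕ j × index i ≡ index j) → ∃[ i ] L ≤ length (f i)
  collide (i , j , i<j , eq) = contradiction (cong toℕ (inj i j (bits-injective (f i) (f j)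
    (pred-injective {{>-nonZero (bits>0 (f i))}} {{>-nonZero (bits>0 (f j))}}
      (trans (sym (toℕ-fromℕ< (index< i))) (trans (cong toℕ eq) (toℕ-fromℕ< (index< j)))))))) (<⇒≢ i<j)

-- The family of arrangements of the blocks.

module Family (x′ a b : ℕ) (3≤k : 3 ≤ suc (a + b)) (k≤x^x : suc (a + b) ≤ suc x′ ^ suc x′) where
  open Ring x′ (a + b)

  choices : Fin (b ^ a) → Fin a → Fin b
  choices = finToFun

  -- Sends blocks to positions; `lift₀` keeps block 0 at position 0, the common reference point of
  -- all members.
  place : Fin (b ^ a) → Permutation′ k
  place i = lift₀ (scramble (choices i))

  -- The code word of block `t` consists of the `x` digits of `t` in base `x`; `k≤x^x` gives each
  -- block its own word.
  letters : Fin k → Fin x → Fin x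
  letters t = finToFun (inject≤ t k≤x^x)

  letters-injective : ∀ s t → (∀ i → letters s i ≡ letters t i) → s ≡ t
  letters-injective s t eq = inject≤-injective k≤x^x k≤x^x s t (finToFun-injective x x _ _ eq)

  -- The inverse of `place` finds the block standing at position `s`.
  code : Fin (b ^ a) → Fin k → Fin x → Fin x
  code i s = letters (place i ⟨$⟩ˡ s)

  code-injective : ∀ i s s′ → (∀ l → code i s l ≡ code i s′ l) → s ≡ s′
  code-injective i s s′ eq = trans (sym (Perm.inverseʳ (place i)))
    (trans (cong (place i ⟨$⟩ʳ_) (letters-injective _ _ eq)) (Perm.inverseʳ (place i)))

  code-place : ∀ i t l → code i (place i ⟨$⟩ʳ t) l ≡ letters t l
  code-place i t l = cong (λ t → letters t l) (Perm.inverseˡ (place i))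

  place-injective : ∀ i j → (∀ t → place i ⟨$⟩ʳ t ≡ place j ⟨$⟩ʳ t) → i ≡ j
  place-injective i j eq = finToFun-injective a b i j
    (scramble-injective (choices i) (choices j) (λ t → suc-injective (eq (suc t))))

  module R (i : Fin (b ^ a)) = Realised 3≤k (code i)

  member : Fin (b ^ a) → Graph (k * suc x)
  member i = R.ringGraph i

  -- The hub of a block sees the same view in all members, so with equal advice it outputs
  -- the same route; block 0 is always placed at position 0, hence the leader's position
  -- is the same, and going back along the routes all blocks have the same positions.
  advice-injective : (oracle : Oracle (k * suc x)) (alg : Alg1) →
    (∀ i → SolvesInTime1 oracle alg (member i)) →
    ∀ i j → oracle (member i) ≡ oracle (member j) → i ≡ j
  advice-injective oracle alg solves i j advice≡ = place-injective i j same-place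
    where
    view : ∀ i → Fin k → Tree
    view i s = B (R.graph i) 1 (R.hub i s)
    answer : ∀ i → Fin k → List (ℕ × ℕ)
    answer i s = alg (oracle (member i)) (view i s)
    out : ∀ i → Fin k → List (ℕ × ℕ)
    out i t = answer i (place i ⟨$⟩ʳ t)
    leader : ∀ i → ∃[ c ] ∀ s → c ≡ route (answer i s) s
    leader i = R.leader-block i (solves i)
    same-view : ∀ t → view i (place i ⟨$⟩ʳ t) ≡ view j (place j ⟨$⟩ʳ t)
    same-view t = trans (R.B1-hub i _) (trans
      (cong node (hub-row 3≤k (code i) (code j) _ _ (λ l → trans (code-place i t l) (sym (code-place j t l)))))
      (sym (R.B1-hub j _)))
    same-out : ∀ t → out i t ≡ out j t
    same-out t = cong₂ alg advice≡ (same-view t)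
    same-leader : proj₁ (leader i) ≡ proj₁ (leader j)
    same-leader = begin
      proj₁ (leader i)     ≡⟨ proj₂ (leader i) zero ⟩
      route (out i zero) zero ≡⟨ cong (λ ps → route ps zero) (same-out zero) ⟩
      route (out j zero) zero ≡⟨ proj₂ (leader j) zero ⟨
      proj₁ (leader j)     ∎
      where open ≡-Reasoning
    same-place : ∀ t → place i ⟨$⟩ʳ t ≡ place j ⟨$⟩ʳ t
    same-place t = route-injective (out j t) _ _ (begin
      route (out j t) (place i ⟨$⟩ʳ t) ≡⟨ cong (λ ps → route ps (place i ⟨$⟩ʳ t)) (same-out t) ⟨
      route (out i t) (place i ⟨$⟩ʳ t) ≡⟨ proj₂ (leader i) (place i ⟨$⟩ʳ t) ⟨
      proj₁ (leader i)                 ≡⟨ same-leader ⟩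
      proj₁ (leader j)                 ≡⟨ proj₂ (leader j) (place j ⟨$⟩ʳ t) ⟩
      route (out j t) (place j ⟨$⟩ʳ t) ∎)
      where open ≡-Reasoning

  feasible : ∀ i → Feasible (member i) × ElectionIndex (member i) 1
  feasible i = B1-injective⇒Feasible (member i) (R.B1-injective i (code-injective i)) , R.electionIndex i (code-injective i)

-- Choice of parameters and estimates.

n<2^n : ∀ n → n < 2 ^ n
n<2^n zero    = ≤-refl
n<2^n (suc n) = begin-strict
  suc n             ≤⟨ n<2^n n ⟩
  2 ^ n             <⟨ ^-monoʳ-< 2 ≤-refl (n<1+n n) ⟩
  2 ^ suc n         ∎
  where open ≤-Reasoning

-- With clique size 1 + x = 2 + 2ᵘ there are xˣ > 2 ^ (u 2ᵘ) = (2ᵉ)² codes, enough for k = 1 + 2ᵉ + 2ᵉ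
-- blocks, whose arrangements number at least (2ᵉ) ^ (2ᵉ) = 2 ^ (e 2ᵉ).
module Size (y : ℕ) where
  open ≤-Reasoning

  z u w x′ e E n : ℕ
  -- The successor gives `w ≥ 2`, hence `e ≥ 2` and `E ≥ 4`.
  z  = suc y
  u  = suc z
  w  = 2 ^ z
  x′ = 2 ^ u
  e  = u * w
  E  = 2 ^ e
  n  = suc (E + E) * suc (suc x′)

  2≤2^suc : ∀ m → 2 ≤ 2 ^ suc m
  2≤2^suc m = *-monoʳ-≤ 2 (m^n>0 2 m)

  2≤e : 2 ≤ e
  2≤e = ≤-trans (2≤2^suc y) (m≤n*m w u)

  4≤E : 4 ≤ E
  4≤E = ^-monoʳ-≤ 2 2≤e

  1≤E : 1 ≤ E
  1≤E = m^n>0 2 e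

  3≤k : 3 ≤ suc (E + E)
  3≤k = s≤s (+-mono-≤ 1≤E 1≤E)

  k≤4E : suc (E + E) ≤ 4 * E
  k≤4E = begin
    1 + (E + E)       ≤⟨ +-monoˡ-≤ (E + E) (≤-trans 1≤E (m≤m+n E E)) ⟩
    E + E + (E + E)   ≡⟨ solve 1 (λ E → E :+ E :+ (E :+ E) := con 4 :* E) refl E ⟩
    4 * E             ∎
    where open +-*-Solver

  k≤x^x : suc (E + E) ≤ suc x′ ^ suc x′
  k≤x^x = begin
    suc (E + E)         ≤⟨ k≤4E ⟩
    4 * E               ≤⟨ *-monoˡ-≤ E 4≤E ⟩
    E * E               ≡⟨ ^-distribˡ-+-* 2 e e ⟨
    2 ^ (e + e)         ≡⟨ cong (2 ^_) (solve 2 (λ u w → u :* w :+ u :* w := u :* (con 2 :* w)) refl u w) ⟩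
    2 ^ (u * x′)        ≡⟨ ^-*-assoc 2 u x′ ⟨
    x′ ^ x′             ≤⟨ ^-monoˡ-≤ x′ (n≤1+n x′) ⟩
    suc x′ ^ x′         ≤⟨ ^-monoʳ-≤ (suc x′) (n≤1+n x′) ⟩
    suc x′ ^ suc x′     ∎
    where open +-*-Solver

  y≤n : y ≤ n
  y≤n = begin
    y                   ≤⟨ ≤-trans (n≤1+n y) (n≤1+n z) ⟩
    u                   ≤⟨ <⇒≤ (n<2^n u) ⟩
    x′                  ≤⟨ ≤-trans (n≤1+n x′) (n≤1+n (suc x′)) ⟩
    suc (suc x′)        ≤⟨ m≤n*m (suc (suc x′)) (suc (E + E)) ⟩
    n                   ∎

  n≤ : n ≤ 4 * E * (4 * w)
  n≤ = *-mono-≤ k≤4E (begin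
    2 + x′              ≤⟨ +-monoˡ-≤ x′ (2≤2^suc z) ⟩
    x′ + x′             ≡⟨ solve 1 (λ w → con 2 :* w :+ con 2 :* w := con 4 :* w) refl w ⟩
    4 * w               ∎)
    where open +-*-Solver

  log-n≤ : ⌊log₂ n ⌋ ≤ 4 + e + z
  log-n≤ = begin
    ⌊log₂ n ⌋                     ≤⟨ ⌊log₂⌋-mono-≤ n≤ ⟩
    ⌊log₂ 4 * E * (4 * w) ⌋       ≡⟨ cong ⌊log₂_⌋ (solve 2 (λ E w → con 4 :* E :* (con 4 :* w) := con 16 :* E :* w) refl E w) ⟩
    ⌊log₂ 16 * E * w ⌋            ≡⟨ cong (λ c → ⌊log₂ c * w ⌋) (^-distribˡ-+-* 2 4 e) ⟨
    ⌊log₂ 2 ^ (4 + e) * 2 ^ z ⌋   ≡⟨ cong ⌊log₂_⌋ (^-distribˡ-+-* 2 (4 + e) z) ⟨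
    ⌊log₂ 2 ^ (4 + e + z) ⌋       ≡⟨ ⌊log₂[2^n]⌋≡n (4 + e + z) ⟩
    4 + e + z                     ∎
    where open +-*-Solver

  -- Both `e` and `3 + u` are at most the square of `x′ = 2 ^ u`; doubling the square costs at most
  -- one more factor `x′`. The crude exponent `3u` suffices, since a second logarithm is taken.
  4+e+z≤ : 4 + e + z ≤ 2 ^ (u + (u + u))
  4+e+z≤ = begin
    4 + e + z              ≡⟨ solve 2 (λ e z → con 4 :+ e :+ z := e :+ (con 3 :+ (con 1 :+ z))) refl e z ⟩
    e + (3 + u)            ≤⟨ +-mono-≤ (*-mono-≤ u≤x′ w≤x′) (+-monoˡ-≤ u (≤-trans (n≤1+n 3) 4≤2u)) ⟩
    x′ * x′ + (2 * u + u)  ≤⟨ +-monoʳ-≤ (x′ * x′) (+-monoʳ-≤ (2 * u) (m≤n*m u 2)) ⟩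
    x′ * x′ + (2 * u + 2 * u) ≡⟨ cong (x′ * x′ +_) (solve 1 (λ u → con 2 :* u :+ con 2 :* u := con 4 :* u) refl u) ⟩
    x′ * x′ + 4 * u        ≤⟨ +-monoʳ-≤ (x′ * x′) (*-mono-≤ 4≤x′ u≤x′) ⟩
    x′ * x′ + x′ * x′      ≡⟨ solve 1 (λ q → q :+ q := con 2 :* q) refl (x′ * x′) ⟩
    2 * (x′ * x′)          ≤⟨ *-monoˡ-≤ (x′ * x′) (2≤2^suc z) ⟩
    x′ * (x′ * x′)         ≡⟨ cong (x′ *_) (^-distribˡ-+-* 2 u u) ⟨
    x′ * 2 ^ (u + u)       ≡⟨ ^-distribˡ-+-* 2 u (u + u) ⟨
    2 ^ (u + (u + u))      ∎
    where
    open +-*-Solver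
    u≤x′ : u ≤ x′
    u≤x′ = <⇒≤ (n<2^n u)
    w≤x′ : w ≤ x′
    w≤x′ = ^-monoʳ-≤ 2 (n≤1+n z)
    4≤2u : 4 ≤ 2 * u
    4≤2u = *-monoʳ-≤ 2 (s≤s (s≤s z≤n))
    4≤x′ : 4 ≤ x′
    4≤x′ = ^-monoʳ-≤ 2 (s≤s (s≤s (z≤n {y})))

  loglog-n≤ : ⌊log₂ ⌊log₂ n ⌋ ⌋ ≤ u + (u + u)
  loglog-n≤ = ≤-trans (⌊log₂⌋-mono-≤ (≤-trans log-n≤ 4+e+z≤)) (≤-reflexive (⌊log₂[2^n]⌋≡n (u + (u + u))))

  -- 48 is 4 · 4 · 3: at most `4 * E` blocks, at most `4 * w` nodes in each, and an iterated
  -- logarithm of at most `3u`, where `u * w` is `e`.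
  n-loglog-n≤ : 1 * n * ⌊log₂ ⌊log₂ n ⌋ ⌋ ≤ 48 * (e * E)
  n-loglog-n≤ = begin
    1 * n * ⌊log₂ ⌊log₂ n ⌋ ⌋           ≡⟨ cong (_* ⌊log₂ ⌊log₂ n ⌋ ⌋) (*-identityˡ n) ⟩
    n * ⌊log₂ ⌊log₂ n ⌋ ⌋               ≤⟨ *-mono-≤ n≤ loglog-n≤ ⟩
    4 * E * (4 * w) * (u + (u + u))     ≡⟨ solve 3 (λ E w u → con 4 :* E :* (con 4 :* w) :* (u :+ (u :+ u)) := con 48 :* (u :* w :* E)) refl E w u ⟩
    48 * (e * E)                        ∎
    where open +-*-Solver

  open Family x′ E E 3≤k k≤x^x public

  long-advice : (oracle : Oracle n) (alg : Alg1) → (∀ i → SolvesInTime1 oracle alg (member i)) →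
    ∃[ i ] e * E ≤ length (oracle (member i))
  long-advice oracle alg solves = long-string (e * E) (oracle ∘ member)
    -- The family has `E ^ E = 2 ^ (e * E)` members.
    (≤-reflexive (sym (^-*-assoc 2 e E))) (advice-injective oracle alg solves)

-- The constant κ is the fraction `a / b`, here 1/48, with the denominator cleared; infinity of `N`
-- is stated as unboundedness.
theorem2 : Σ ℕ λ a → Σ ℕ λ b → 1 ≤ a × 1 ≤ b ×
    Σ (ℕ → Set) λ N →
    (∀ n → N n → 1 ≤ n) ×
    (∀ m → Σ ℕ λ n → m ≤ n × N n) ×
    (∀ n → N n →
    Σ (Graph n → Set) λ 𝒢 →
    (∀ G → 𝒢 G → Feasible G × ElectionIndex G 1) ×
    (∀ (oracle : Oracle n) (alg : Alg1) →
    (∀ G → 𝒢 G → SolvesInTime1 oracle alg G) →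
    Σ (Graph n) λ G → 𝒢 G × a * n * ⌊log₂ ⌊log₂ n ⌋ ⌋ ≤ b * length (oracle G)))
theorem2 = 1 , 48 , s≤s z≤n , s≤s z≤n , (λ n → ∃[ y ] n ≡ Size.n y) ,
  (λ { n (y , refl) → s≤s z≤n }) ,
  (λ m → Size.n m , Size.y≤n m , m , refl) ,
  λ { n (y , refl) →
    let open Size y in
    (λ G → ∃[ i ] G ≡ member i) ,
    (λ { G (i , refl) → feasible i }) ,
    λ oracle alg solves →
      let (i , long) = long-advice oracle alg (λ i → solves (member i) (i , refl))
      in member i , (i , refl) , ≤-trans n-loglog-n≤ (*-monoʳ-≤ 48 long) }
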